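{- Let $G$ be a graph of treewidth $w\geq 2$ and let $k\geq w+1$ be an integer (with $k\leq |V(G)|$, so that $\operatorname{nc}(G,k)$ is defined). Then $\operatorname{nc}(G,k)\leq (k-w+1)2^{w}+w$.
   Context: All graphs are finite, simple and undirected. For a vertex $v$ of a graph $G$, $N[v]$ denotes the closed neighbourhood of $v$ ($v$ together with its neighbours). For a graph $G=(V,E)$ and $S\subseteq V$, $\operatorname{nc}(G,S)=|\{N[u]\cap S : u\in V\}|$ (the empty intersection is counted if it occurs). For an integer $k$, $\operatorname{nc}(G,k)=\max_{S\subseteq V,\ |S|=k}\operatorname{nc}(G,S)$. A tree-decomposition of $G$ is a pair $(T,X)$ where $T$ is a tree and $X$ maps each node of $T$ to a subset of $V(G)$ (its bag), such that every edge of $G$ is contained in some bag, and for every $v\in V(G)$ the set of nodes whose bags contain $v$ induces a non-empty subtree of $T$. Its width is the maximum bag size minus $1$; the treewidth of $G$ is the minimum width of a tree-decomposition of $G$. -}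

module Defs where

open import Level using (0ℓ)
open import Data.Bool.Properties using () renaming (_≟_ to _≟ᵇ_)
open import Data.Fin using (Fin)
open import Data.Fin.Properties using (_≟_)
open import Data.Fin.Subset using (Subset; inside; outside; _∈_; _∩_; ∣_∣)
open import Data.Integer as ℤ using (ℤ; _⊖_)
open import Data.List
  using (List; []; _∷_; [_]; _∷ʳ_; _++_; map; filter; length; allFin; deduplicate)
open import Data.List.Extrema.Nat using (max)
open import Data.List.Relation.Unary.Linked using (Linked)
open import Data.List.Relation.Unary.Unique.Propositional using (Unique)
open import Data.Nat as ℕ using (ℕ; zero; suc; _≤_)
open import Data.Product using (Σ; ∃; ∃-syntax; _×_; proj₁)
open import Data.Vec as Vec using (tabulate)
open import Data.Vec.Properties using (≡-dec)
open import Relation.Binary.Construct.Closure.ReflexiveTransitive using (Star)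
open import Relation.Binary.Core using (Rel)
open import Relation.Binary.Definitions using (Decidable; Irreflexive; Symmetric)
open import Relation.Binary.PropositionalEquality using (_≡_; cong)
open import Relation.Nullary using (¬_; does; _⊎-dec_)

-- Simple undirected graphs on the vertex type V; the finite ones are the
-- inhabitants of Graph (Fin n).
record Graph (V : Set) : Set₁ where
  infix 4 _~_ _~?_
  field
    _~_    : Rel V 0ℓ
    _~?_   : Decidable _~_
    sym    : Symmetric _~_
    irrefl : Irreflexive _≡_ _~_

-- When P is membership in a Subset, its proofs are unique, so the pairs in
-- Σ V P are equal exactly when the underlying vertices are.
induced : {V : Set} → Graph V → (P : V → Set) → Graph (Σ V P)
induced G P = record
  { _~_    = λ x y → proj₁ x ~ proj₁ y
  ; _~?_   = λ x y → proj₁ x ~? proj₁ y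
  ; sym    = sym
  ; irrefl = λ x≡y → irrefl (cong proj₁ x≡y)
  }
  where
  open Graph G

module _ {V : Set} (G : Graph V) where
  open Graph G

  Connected : Set
  Connected = ∀ u v → Star _~_ u v

  -- The cycle x, y₁, …, yₗ, x with l ≥ 2, where ys = y₁, …, yₗ.
  IsCycle : V → List V → Set
  IsCycle x ys = 2 ≤ length ys × Unique (x ∷ ys) × Linked _~_ (x ∷ ys ∷ʳ x)

  Acyclic : Set
  Acyclic = ∀ x ys → ¬ IsCycle x ys

  record IsTree : Set where
    field
      nonempty  : V
      connected : Connected
      acyclic   : Acyclic

allSubsets : ∀ n → List (Subset n)
allSubsets zero    = [ Vec.[] ]
allSubsets (suc n) =
  map (outside Vec.∷_) (allSubsets n) ++ map (inside Vec.∷_) (allSubsets n)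

module _ {n : ℕ} (G : Graph (Fin n)) where
  open Graph G

  N[_] : Fin n → Subset n
  N[ v ] = tabulate λ u → does ((u ≟ v) ⊎-dec (v ~? u))

  nc : Subset n → ℕ
  nc S = length (deduplicate (≡-dec _≟ᵇ_) (map (λ u → N[ u ] ∩ S) (allFin n)))

  -- The default 0 matters only for k > n, where no S of size k exists.
  ncₖ : ℕ → ℕ
  ncₖ k = max 0 (map nc (filter (λ S → ∣ S ∣ ℕ.≟ k) (allSubsets n)))

  record TreeDecomposition : Set₁ where
    field
      {nodes}      : ℕ
      tree         : Graph (Fin nodes)
      isTree       : IsTree tree
      bag          : Fin nodes → Subset n
      edge-covered : ∀ u v → u ~ v → ∃[ t ] (u ∈ bag t × v ∈ bag t)
      subtree      : ∀ v → IsTree (induced tree (λ t → v ∈ bag t))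

    -- Integer-valued, as the graph without vertices has a decomposition of
    -- width -1.
    width : ℤ
    width = max 0 (map (λ t → ∣ bag t ∣) (allFin nodes)) ⊖ 1

  open TreeDecomposition using (width)

  IsTreewidth : ℤ → Set₁
  IsTreewidth w =
    (∃ λ (D : TreeDecomposition) → width D ≡ w) ×
    (∀ (D : TreeDecomposition) → w ℤ.≤ width D)

{-# OPTIONS --safe #-}

-- Let H be the graph on S whose edges join vertices sharing a bag. A vertex u outside S
-- whose trace on S is not a clique of H is contracted into a member x of its trace, by
-- replacing u with x in every bag; this makes some missing edge {x , y} appear in H, and u is
-- charged to the clique {x , y}, of size 2 ≤ w. Once no contraction is possible, the remaining
-- traces are cliques of H, and by the Helly property such a trace lies in a bag together with
-- its vertex, so that it has at most w elements. Hence the traces of the vertices outside S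
-- inject into the cliques of size at most w of a graph with k vertices and treewidth at most w,
-- of which there are at most 2 ^ w + (k - w) * (2 ^ w - 1): removing the vertex whose subtree
-- starts farthest from the root destroys at most 2 ^ w - 1 of them, until w vertices remain.
-- The vertices of S contribute at most k further traces.
module Submission where

open import Defs
open import Data.Bool using (if_then_else_)
open import Data.Bool.Properties using () renaming (_≟_ to _≟ᵇ_)
open import Data.Empty using (⊥-elim)
open import Data.Fin using (Fin; zero; suc)
open import Data.Fin.Properties using (_≟_; any?)
open import Data.Fin.Subset
  using (Subset; Nonempty; inside; outside; _∈_; _∉_; _⊆_; _∪_; _∩_; _-_; ⁅_⁆; ∣_∣)
open import Data.Fin.Subset.Properties
open import Data.Integer using (+_; _⊖_)
import Data.Integer.Properties as ℤ
open import Data.List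
  using (List; []; _∷_; [_]; _∷ʳ_; _++_; filter; allFin; length; map; deduplicate)
open import Data.List.Extrema.Nat
  using (max; max≤v⁺; xs≤max; argmax; argmax-all; f[xs]≤f[argmax]; argmin; argmin-all; f[argmin]≤f[xs])
open import Data.List.Membership.Propositional
  using (find; lose) renaming (_∈_ to _∈ₗ_; _∉_ to _∉ₗ_)
open import Data.List.Membership.Propositional.Properties
  using (∈-filter⁺; ∈-filter⁻; ∈-allFin; ∈-∃++; ∈-map⁺; ∈-map⁻; ∈-++⁺ˡ; ∈-++⁺ʳ; ∈-++⁻; ∈-deduplicate⁻)
open import Data.List.Properties using (length-map; length-++; ++-identityʳ)
open import Data.List.Relation.Binary.Permutation.Propositional using (_↭_; ↭-sym; ↭⇒↭ₛ)
open import Data.List.Relation.Binary.Permutation.Propositional.Properties as ↭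
  using (∈-resp-↭; ↭-length; shift)
import Data.List.Relation.Binary.Permutation.Setoid.Properties as ↭ₛ
open import Data.List.Relation.Binary.Subset.Propositional using () renaming (_⊆_ to _⊆ₗ_)
open import Data.List.Relation.Unary.All as All using (All; []; _∷_)
open import Data.List.Relation.Unary.All.Properties as All
  using (all-filter; ¬Any⇒All¬; All¬⇒¬Any)
open import Data.List.Relation.Unary.AllPairs using ([]; _∷_; tail)
open import Data.List.Relation.Unary.Any as Any using (Any; here; there)
open import Data.List.Relation.Unary.Linked using (Linked; [-]; _∷_)
open import Data.List.Relation.Unary.Unique.Propositional using (Unique)
import Data.List.Relation.Unary.Unique.DecPropositional.Properties as UniqueDec
import Data.List.Relation.Unary.Unique.Propositional.Properties as Unique
open import Data.Nat as ℕ using (ℕ; zero; suc; _+_; _*_; _∸_; _^_; _≤_; _<_; z≤n; s≤s)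
open import Data.Nat.Induction using (Acc; acc; <-wellFounded)
open import Data.Nat.Properties hiding (_≟_)
open import Data.Nat.Solver using (module +-*-Solver)
open import Data.Product using (Σ; ∃; ∃-syntax; _×_; _,_; proj₁; proj₂)
open import Data.Sum as Sum using (_⊎_; inj₁; inj₂)
open import Data.Vec using ([]; _∷_; here; there)
open import Data.Vec.Properties using (≡-dec; lookup∘tabulate; []=⇒lookup)
open import Level using (0ℓ)
open import Relation.Binary.Construct.Closure.ReflexiveTransitive using (Star; ε; _◅_)
open import Relation.Binary.Core using (Rel)
open import Relation.Binary.Definitions using (DecidableEquality; tri<; tri≈; tri>)
open import Relation.Binary.PropositionalEquality
  using (_≡_; _≢_; refl; sym; trans; cong; cong₂; subst; subst₂; setoid)
open import Relation.Nullary using (Dec; yes; no; does; ¬_; ¬?; _×-dec_)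
open import Relation.Nullary.Decidable using (decidable-stable)
open import Relation.Unary using (Pred; Decidable)

-- Ranking the nodes of a tree

module Rank {V : Set} (_≟_ : DecidableEquality V) (G : Graph V) (acyclic : Acyclic G) where
  open Graph G using (_~_; irrefl) renaming (sym to ~-sym)
  open import Data.List.Membership.DecPropositional _≟_ using () renaming (_∈?_ to _∈ₗ?_)

  -- Paths without repeated vertices, indexed by the vertices visited: with one more vertex at the
  -- ends, such a list closes up to an `IsCycle`.
  data Path : V → V → List V → Set where
    stop : ∀ {a} → Path a a [ a ]
    step : ∀ {a b c l} → a ~ b → Path b c l → a ∉ₗ l → Path a c (a ∷ l)

  path-unique : ∀ {a b l} → Path a b l → Unique l
  path-unique stop           = [] ∷ []
  path-unique (step _ p a∉l) = ¬Any⇒All¬ _ a∉l ∷ path-unique p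

  path-snoc : ∀ {a b c l} → Path a b l → b ~ c → c ∉ₗ l → Path a c (l ∷ʳ c)
  path-snoc stop b~c c∉l = step b~c stop λ { (here refl) → c∉l (here refl) }
  path-snoc {l = a ∷ l} (step a~a′ p a∉l) b~c c∉l =
    step a~a′ (path-snoc p b~c λ c∈l → c∉l (there c∈l)) a∉l∷ʳc
    where
    a∉l∷ʳc : a ∉ₗ l ∷ʳ _
    a∉l∷ʳc a∈ with ∈-++⁻ l a∈
    ... | inj₁ a∈l         = a∉l a∈l
    ... | inj₂ (here refl) = c∉l (here refl)

  path-linked : ∀ {y a b l z} → y ~ a → Path a b l → b ~ z → Linked _~_ (y ∷ l ∷ʳ z)
  path-linked y~a stop           b~z = y~a ∷ b~z ∷ [-]
  path-linked y~a (step a~c p _) b~z = y~a ∷ path-linked a~c p b~z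

  path-length : ∀ {a b l} → Path a b l → a ≢ b → 2 ≤ length l
  path-length stop                    a≢b = ⊥-elim (a≢b refl)
  path-length (step _ stop _)         _   = s≤s (s≤s z≤n)
  path-length (step _ (step _ _ _) _) _   = s≤s (s≤s z≤n)

  -- `L` lists the nodes absorbed so far, and ranks follow the order of absorption. The field `path`
  -- keeps `L` connected within itself, which is what makes earlier neighbours unique when a node is
  -- added.
  record Ranking (L : List V) : Set where
    field
      rank          : V → ℕ
      rank-<        : ∀ {v} → v ∈ₗ L → rank v < length L
      path          : ∀ {a b} → a ∈ₗ L → b ∈ₗ L → ∃[ l ] Path a b l × l ⊆ₗ L
      rank-≢        : ∀ {a b} → a ∈ₗ L → b ∈ₗ L → a ~ b → rank a ≢ rank b
      parent-unique : ∀ {a b c} → a ∈ₗ L → b ∈ₗ L → c ∈ₗ L → a ~ c → b ~ c →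
                      rank a < rank c → rank b < rank c → a ≡ b

  open Ranking

  singleton : ∀ r → Ranking [ r ]
  singleton r = record
    { rank          = λ _ → 0
    ; rank-<        = λ _ → s≤s z≤n
    ; path          = λ { (here refl) (here refl) → [ r ] , stop , λ v∈ → v∈ }
    ; rank-≢        = λ { (here refl) (here refl) r~r _ → irrefl refl r~r }
    ; parent-unique = λ _ _ _ _ _ ()
    }

  -- Two different neighbours of `y` would be joined by a path inside `L`, and this path, avoiding
  -- `y`, would close up to a cycle through `y`.
  neighbour-unique : ∀ {L y a b} → Ranking L → y ∉ₗ L → a ∈ₗ L → b ∈ₗ L →
                     a ~ y → b ~ y → a ≡ b
  neighbour-unique {L} {y} {a} {b} R y∉L a∈L b∈L a~y b~y with a ≟ b
  ... | yes a≡b = a≡b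
  ... | no  a≢b with path R a∈L b∈L
  ...   | l , p , l⊆L = ⊥-elim (acyclic y l
          ( path-length p a≢b
          , ¬Any⇒All¬ _ (λ y∈l → y∉L (l⊆L y∈l)) ∷ path-unique p
          , path-linked (~-sym a~y) p b~y ))

  extend : ∀ {L x y} → Ranking L → x ∈ₗ L → y ∉ₗ L → y ~ x → Ranking (y ∷ L)
  extend {L} {x} {y} R x∈L y∉L y~x = record
    { rank = rank′ ; rank-< = rank′-< ; path = path′
    ; rank-≢ = rank′-≢ ; parent-unique = parent-unique′ }
    where
    rank′ : V → ℕ
    rank′ v with v ≟ y
    ... | yes _ = length L
    ... | no  _ = rank R v

    rank′-y : rank′ y ≡ length L
    rank′-y with y ≟ y
    ... | yes _  = refl
    ... | no y≢y = ⊥-elim (y≢y refl)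

    rank′-∈ : ∀ {v} → v ∈ₗ L → rank′ v ≡ rank R v
    rank′-∈ {v} v∈L with v ≟ y
    ... | yes refl = ⊥-elim (y∉L v∈L)
    ... | no  _    = refl

    rank′-∈-< : ∀ {v} → v ∈ₗ L → rank′ v < length L
    rank′-∈-< v∈L = subst (_< length L) (sym (rank′-∈ v∈L)) (rank-< R v∈L)

    rank′-< : ∀ {v} → v ∈ₗ y ∷ L → rank′ v < suc (length L)
    rank′-< (here refl) = s≤s (≤-reflexive rank′-y)
    rank′-< (there v∈L) = m<n⇒m<1+n (rank′-∈-< v∈L)

    -- The new node has the largest rank, so it is never the parent of an older one.
    y≮ : ∀ {v} → v ∈ₗ L → rank′ y < rank′ v → ∀ {A : Set} → A
    y≮ v∈L y<v = ⊥-elim (<-asym (subst (_< rank′ _) rank′-y y<v) (rank′-∈-< v∈L))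

    path′ : ∀ {a b} → a ∈ₗ y ∷ L → b ∈ₗ y ∷ L → ∃[ l ] Path a b l × l ⊆ₗ y ∷ L
    path′ (here refl) (here refl) = [ y ] , stop , λ { (here refl) → here refl }
    path′ (here refl) (there b∈L) with path R x∈L b∈L
    ... | l , p , l⊆L = y ∷ l , step y~x p (λ y∈l → y∉L (l⊆L y∈l)) ,
          λ { (here refl) → here refl ; (there v∈l) → there (l⊆L v∈l) }
    path′ (there a∈L) (here refl) with path R a∈L x∈L
    ... | l , p , l⊆L = l ∷ʳ y , path-snoc p (~-sym y~x) (λ y∈l → y∉L (l⊆L y∈l)) , l∷ʳy⊆
      where
      l∷ʳy⊆ : l ∷ʳ y ⊆ₗ y ∷ L
      l∷ʳy⊆ v∈ with ∈-++⁻ l v∈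
      ... | inj₁ v∈l         = there (l⊆L v∈l)
      ... | inj₂ (here refl) = here refl
    path′ (there a∈L) (there b∈L) with path R a∈L b∈L
    ... | l , p , l⊆L = l , p , λ v∈l → there (l⊆L v∈l)

    rank′-≢ : ∀ {a b} → a ∈ₗ y ∷ L → b ∈ₗ y ∷ L → a ~ b → rank′ a ≢ rank′ b
    rank′-≢ (here refl) (here refl) a~b _ = irrefl refl a~b
    rank′-≢ (here refl) (there b∈L) _ eq =
      <-irrefl (trans (sym eq) rank′-y) (rank′-∈-< b∈L)
    rank′-≢ (there a∈L) (here refl) _ eq =
      <-irrefl (trans eq rank′-y) (rank′-∈-< a∈L)
    rank′-≢ (there a∈L) (there b∈L) a~b eq =
      rank-≢ R a∈L b∈L a~b (trans (sym (rank′-∈ a∈L)) (trans eq (rank′-∈ b∈L)))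

    parent-unique′ : ∀ {a b c} → a ∈ₗ y ∷ L → b ∈ₗ y ∷ L → c ∈ₗ y ∷ L → a ~ c → b ~ c →
                     rank′ a < rank′ c → rank′ b < rank′ c → a ≡ b
    parent-unique′ (here refl) _ (here refl) a~c = ⊥-elim (irrefl refl a~c)
    parent-unique′ _ (here refl) (here refl) _ b~c = ⊥-elim (irrefl refl b~c)
    parent-unique′ (there a∈L) (there b∈L) (here refl) a~c b~c _ _ =
      neighbour-unique R y∉L a∈L b∈L a~c b~c
    parent-unique′ (here refl) _ (there c∈L) _ _ y<c = y≮ c∈L y<c
    parent-unique′ _ (here refl) (there c∈L) _ _ _ y<c = y≮ c∈L y<c
    parent-unique′ (there a∈L) (there b∈L) (there c∈L) a~c b~c a<c b<c =
      parent-unique R a∈L b∈L c∈L a~c b~c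
        (subst₂ _<_ (rank′-∈ a∈L) (rank′-∈ c∈L) a<c)
        (subst₂ _<_ (rank′-∈ b∈L) (rank′-∈ c∈L) b<c)

  -- The walk is absorbed from its end at `r` backwards, so that each new node is adjacent to one
  -- already ranked.
  absorb : ∀ {L v r} → Ranking L → r ∈ₗ L → Star _~_ v r →
           ∃[ L′ ] L ⊆ₗ L′ × v ∈ₗ L′ × Ranking L′
  absorb {L} R r∈L ε = L , (λ u∈ → u∈) , r∈L , R
  absorb {v = v} R r∈L (v~u ◅ walk) with absorb R r∈L walk
  ... | L′ , L⊆L′ , u∈L′ , R′ with v ∈ₗ? L′
  ...   | yes v∈L′ = L′ , L⊆L′ , v∈L′ , R′
  ...   | no  v∉L′ = v ∷ L′ , (λ u∈ → there (L⊆L′ u∈)) , here refl ,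
                     extend R′ u∈L′ v∉L′ v~u

  absorbAll : ∀ {r} → (∀ v → Star _~_ v r) → ∀ vs → ∃[ L ] r ∈ₗ L × vs ⊆ₗ L × Ranking L
  absorbAll {r} walk [] = [ r ] , here refl , (λ ()) , singleton r
  absorbAll walk (v ∷ vs) with absorbAll walk vs
  ... | L , r∈L , vs⊆L , R with absorb R r∈L (walk v)
  ...   | L′ , L⊆L′ , v∈L′ , R′ =
          L′ , L⊆L′ r∈L , (λ { (here refl) → v∈L′ ; (there u∈) → L⊆L′ (vs⊆L u∈) }) , R′

-- Subtrees of a rooted tree

module _ {n} {A : Pred (Fin n) 0ℓ} (A? : Decidable A) (f : Fin n → ℕ) where

  ∃-maximum : ∃ A → ∃[ v ] A v × ∀ {u} → A u → f u ≤ f v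
  ∃-maximum (v , av) =
    argmax f v xs , argmax-all f {P = A} av (all-filter A? (allFin n)) ,
    λ {u} au → All.lookup (f[xs]≤f[argmax] {f = f} v xs) (∈-filter⁺ A? (∈-allFin u) au)
    where xs = filter A? (allFin n)

  ∃-minimum : ∃ A → ∃[ v ] A v × ∀ {u} → A u → f v ≤ f u
  ∃-minimum (v , av) =
    argmin f v xs , argmin-all f {P = A} av (all-filter A? (allFin n)) ,
    λ {u} au → All.lookup (f[argmin]≤f[xs] {f = f} v xs) (∈-filter⁺ A? (∈-allFin u) au)
    where xs = filter A? (allFin n)

-- `p ◁ x` reads: `p` is the parent of `x`. The rank need not be the depth; it only has to grow from
-- parent to child.
record Rooting (V : Set) : Set₁ where
  infix 4 _◁_
  field
    _◁_      : Rel V 0ℓ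
    rank     : V → ℕ
    ◁⇒<      : ∀ {p x} → p ◁ x → rank p < rank x
    ◁-unique : ∀ {p q x} → p ◁ x → q ◁ x → p ≡ q

module Subtrees {V : Set} (rooting : Rooting V) where
  open Rooting rooting

  -- Connectedness is recast as a condition on single nodes, closure under parents up to `top`,
  -- which is easy to carry over to unions.
  record IsSubtree (top : V) (C : Pred V 0ℓ) : Set where
    field
      top∈  : C top
      climb : ∀ {x} → C x → x ≡ top ⊎ ∃[ p ] p ◁ x × C p

  open IsSubtree

  private
    variable
      s t x : V
      C D : Pred V 0ℓ

  top-minimum : IsSubtree t C → C x → rank t ≤ rank x
  top-minimum {t = t} {C} T = go (<-wellFounded _)
    where
    go : ∀ {x} → Acc _<_ (rank x) → C x → rank t ≤ rank x
    go (acc rs) x∈C with climb T x∈C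
    ... | inj₁ refl              = ≤-refl
    ... | inj₂ (p , p◁x , p∈C) = <⇒≤ (≤-<-trans (go (rs (◁⇒< p◁x)) p∈C) (◁⇒< p◁x))

  -- Climb from the common node `x` towards `t`. Parents are unique, so the climb stays in both
  -- sets. It cannot pass `s` first, since the next node in `D` would have rank below that of `t`.
  top∈-meeting : IsSubtree s C → IsSubtree t D → C x → D x → rank s ≤ rank t → C t
  top∈-meeting {s} {C} {t} {D} S T x∈C x∈D s≤t = go (<-wellFounded _) x∈C x∈D
    where
    go : ∀ {x} → Acc _<_ (rank x) → C x → D x → C t
    go (acc rs) x∈C x∈D with climb T x∈D | climb S x∈C
    ... | inj₁ refl            | _         = x∈C
    ... | inj₂ (p , p◁x , p∈D) | inj₁ refl =
          ⊥-elim (<⇒≱ (◁⇒< p◁x) (≤-trans s≤t (top-minimum T p∈D)))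
    ... | inj₂ (p , p◁x , p∈D) | inj₂ (q , q◁x , q∈C) =
          go (rs (◁⇒< p◁x)) (subst C (◁-unique q◁x p◁x) q∈C) p∈D

  union : IsSubtree s C → IsSubtree t D → C x → D x → rank s ≤ rank t →
          IsSubtree s (λ y → C y ⊎ D y)
  union {s} {C} {t} {D} S T x∈C x∈D s≤t = record { top∈ = inj₁ (top∈ S) ; climb = up }
    where
    upC : ∀ {y} → C y → y ≡ s ⊎ ∃[ p ] p ◁ y × (C p ⊎ D p)
    upC y∈C = Sum.map₂ (λ (p , p◁y , p∈C) → p , p◁y , inj₁ p∈C) (climb S y∈C)
    up : ∀ {y} → C y ⊎ D y → y ≡ s ⊎ ∃[ p ] p ◁ y × (C p ⊎ D p)
    up (inj₁ y∈C) = upC y∈C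
    up (inj₂ y∈D) with climb T y∈D
    -- At its own top the second subtree offers no parent, but this top lies in `C`, where the climb
    -- continues.
    ... | inj₁ refl            = upC (top∈-meeting S T x∈C x∈D s≤t)
    ... | inj₂ (p , p◁y , p∈D) = inj₂ (p , p◁y , inj₂ p∈D)

  IsSubtree-resp : (∀ {x} → C x → D x) → (∀ {x} → D x → C x) → IsSubtree t C → IsSubtree t D
  IsSubtree-resp C⇒D D⇒C T = record
    { top∈  = C⇒D (top∈ T)
    ; climb = λ x∈D → Sum.map₂ (λ (p , p◁x , p∈C) → p , p◁x , C⇒D p∈C) (climb T (D⇒C x∈D))
    }

  data Descendant (y : V) : V → Set where
    self  : Descendant y y
    child : ∀ {p z} → p ◁ z → Descendant y p → Descendant y z

  descendant-≤ : ∀ {y z} → Descendant y z → rank y ≤ rank z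
  descendant-≤ self          = ≤-refl
  descendant-≤ (child p◁z d) = <⇒≤ (≤-<-trans (descendant-≤ d) (◁⇒< p◁z))

  module _ (G : Graph V) (orient : ∀ {x y} → Graph._~_ G x y → x ◁ y ⊎ y ◁ x) where

    -- The only edge leaving the descendants of y leads to the parent of y.
    leave : ∀ {y a b} → Star (Graph._~_ (induced G C)) a b → Descendant y (proj₁ a) →
            Descendant y (proj₁ b) ⊎ ∃[ p ] p ◁ y × C p
    leave ε d = inj₁ d
    leave (_◅_ {j = _ , z∈C} x~z walk) d with orient x~z | d
    ... | inj₁ x◁z | _            = leave walk (child x◁z d)
    ... | inj₂ z◁x | self         = inj₂ (_ , z◁x , z∈C)
    ... | inj₂ z◁x | child p◁x d′ with ◁-unique z◁x p◁x
    ...   | refl = leave walk d′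

    -- Follow a walk inside `C` from `x` to `t`. Either it leaves the descendants of `x`, through
    -- the parent of `x`, which then lies in `C`, or `t` is a descendant of `x`, and minimality of
    -- its rank forces `t` to be `x`.
    connected⇒isSubtree : Connected (induced G C) → C t →
                          (∀ {x} → C x → rank t ≤ rank x) → IsSubtree t C
    connected⇒isSubtree {C} {t} conn t∈C t-min = record { top∈ = t∈C ; climb = up }
      where
      up : ∀ {x} → C x → x ≡ t ⊎ ∃[ p ] p ◁ x × C p
      up x∈C with leave (conn (_ , x∈C) (_ , t∈C)) self
      ... | inj₂ parent          = inj₂ parent
      ... | inj₁ self            = inj₁ refl
      ... | inj₁ (child p◁t d) =
            ⊥-elim (<⇒≱ (≤-<-trans (descendant-≤ d) (◁⇒< p◁t)) (t-min x∈C))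

-- Counting sets and cliques

private
  variable
    A : Set
    n : ℕ

∈⇒↭ : ∀ {x : A} {xs} → x ∈ₗ xs → ∃[ ys ] xs ↭ x ∷ ys
∈⇒↭ x∈xs with ∈-∃++ x∈xs
... | as , bs , refl = as ++ bs , shift _ as bs

Unique-resp-↭ : ∀ {xs ys : List A} → xs ↭ ys → Unique xs → Unique ys
Unique-resp-↭ xs↭ys = ↭ₛ.Unique-resp-↭ (setoid _) (↭⇒↭ₛ xs↭ys)

Unique-head : ∀ {x : A} {xs} → Unique (x ∷ xs) → x ∉ₗ xs
Unique-head (x≢ ∷ _) = All¬⇒¬Any x≢

length-⊆ : ∀ {xs ys : List A} → Unique xs → (∀ {x} → x ∈ₗ xs → x ∈ₗ ys) → length xs ≤ length ys
length-⊆ [] _ = z≤n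
length-⊆ {xs = x ∷ xs} {ys} u@(_ ∷ uxs) xs⊆ys with ∈⇒↭ (xs⊆ys (here refl))
... | zs , ys↭ = subst (suc (length xs) ≤_) (sym (↭-length ys↭)) (s≤s (length-⊆ uxs xs⊆zs))
  where
  xs⊆zs : ∀ {y} → y ∈ₗ xs → y ∈ₗ zs
  xs⊆zs y∈xs with ∈-resp-↭ ys↭ (xs⊆ys (there y∈xs))
  ... | here refl  = ⊥-elim (Unique-head u y∈xs)
  ... | there y∈zs = y∈zs

length-filter-¬ : ∀ {P : Pred A 0ℓ} (P? : Decidable P) xs →
                  length xs ≡ length (filter (λ x → ¬? (P? x)) xs) + length (filter P? xs)
length-filter-¬ P? [] = refl
length-filter-¬ P? (x ∷ xs) with P? x
... | yes _ = trans (cong suc (length-filter-¬ P? xs)) (sym (+-suc _ _))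
... | no  _ = cong suc (length-filter-¬ P? xs)

elements : Subset n → List (Fin n)
elements []            = []
elements (inside  ∷ p) = zero ∷ map suc (elements p)
elements (outside ∷ p) = map suc (elements p)

length-elements : ∀ (p : Subset n) → length (elements p) ≡ ∣ p ∣
length-elements []            = refl
length-elements (inside  ∷ p) = cong suc (trans (length-map suc (elements p)) (length-elements p))
length-elements (outside ∷ p) = trans (length-map suc (elements p)) (length-elements p)

∈-elements : ∀ {x} {p : Subset n} → x ∈ p → x ∈ₗ elements p
∈-elements here                              = here refl
∈-elements {p = inside  ∷ _} (there x∈p) = there (∈-map⁺ suc (∈-elements x∈p))
∈-elements {p = outside ∷ _} (there x∈p) = ∈-map⁺ suc (∈-elements x∈p)

powerset : Subset n → List (Subset n)
powerset []            = [] ∷ []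
powerset (outside ∷ p) = map (outside ∷_) (powerset p)
powerset (inside  ∷ p) = map (outside ∷_) (powerset p) ++ map (inside ∷_) (powerset p)

length-powerset : ∀ (p : Subset n) → length (powerset p) ≡ 2 ^ ∣ p ∣
length-powerset []            = refl
length-powerset (outside ∷ p) = trans (length-map _ (powerset p)) (length-powerset p)
length-powerset (inside  ∷ p) = trans
  (length-++ (map (outside ∷_) (powerset p)))
  (cong₂ _+_ (trans (length-map _ (powerset p)) (length-powerset p))
             (trans (length-map _ (powerset p)) (trans (length-powerset p) (sym (+-identityʳ _)))))

⊆⇒∈-powerset : ∀ {p q : Subset n} → p ⊆ q → p ∈ₗ powerset q
⊆⇒∈-powerset {p = []}          {[]}          _   = here refl
⊆⇒∈-powerset {p = outside ∷ p} {outside ∷ q} p⊆q = ∈-map⁺ _ (⊆⇒∈-powerset (drop-∷-⊆ p⊆q))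
⊆⇒∈-powerset {p = outside ∷ p} {inside  ∷ q} p⊆q =
  ∈-++⁺ˡ (∈-map⁺ _ (⊆⇒∈-powerset (drop-∷-⊆ p⊆q)))
⊆⇒∈-powerset {p = inside  ∷ p} {inside  ∷ q} p⊆q =
  ∈-++⁺ʳ _ (∈-map⁺ _ (⊆⇒∈-powerset (drop-∷-⊆ p⊆q)))
⊆⇒∈-powerset {p = inside  ∷ p} {outside ∷ q} p⊆q with p⊆q here
... | ()

x∉p-x : ∀ {x} (p : Subset n) → x ∉ p - x
-- Removing `x` a second time would shrink the set, yet changes nothing.
x∉p-x {x = x} p x∈ = <-irrefl (cong ∣_∣ (p─q─q≡p─q p ⁅ x ⁆)) (x∈p⇒∣p-x∣<∣p∣ x∈)

∣p∣≤1+∣p-x∣ : ∀ (p : Subset n) x → ∣ p ∣ ≤ suc ∣ p - x ∣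
∣p∣≤1+∣p-x∣ (outside ∷ p) zero    = ≤-trans (≤-reflexive (cong ∣_∣ (sym (p─⊥≡p p)))) (n≤1+n _)
∣p∣≤1+∣p-x∣ (inside  ∷ p) zero    = s≤s (≤-reflexive (cong ∣_∣ (sym (p─⊥≡p p))))
∣p∣≤1+∣p-x∣ (outside ∷ p) (suc x) = ∣p∣≤1+∣p-x∣ p x
∣p∣≤1+∣p-x∣ (inside  ∷ p) (suc x) = s≤s (∣p∣≤1+∣p-x∣ p x)

x∈p∪⁅x⁆ : ∀ (p : Subset n) x → x ∈ p ∪ ⁅ x ⁆
x∈p∪⁅x⁆ p x = x∈p∪q⁺ (inj₂ (x∈⁅x⁆ x))

x∈p∪⁅y⁆⁻ : ∀ (p : Subset n) {x y} → x ∈ p ∪ ⁅ y ⁆ → x ∈ p ⊎ x ≡ y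
x∈p∪⁅y⁆⁻ p {y = y} x∈ = Sum.map₂ (x∈⁅y⁆⇒x≡y y) (x∈p∪q⁻ p ⁅ y ⁆ x∈)

∣p∪⁅x⁆∣≤1+∣p∣ : ∀ (p : Subset n) x → ∣ p ∪ ⁅ x ⁆ ∣ ≤ suc ∣ p ∣
∣p∪⁅x⁆∣≤1+∣p∣ p x = ≤-trans (∣p∣≤1+∣p-x∣ (p ∪ ⁅ x ⁆) x) (s≤s (p⊆q⇒∣p∣≤∣q∣ ⊆p))
  where
  ⊆p : (p ∪ ⁅ x ⁆) - x ⊆ p
  ⊆p y∈ with x∈p∪⁅y⁆⁻ p (p─q⊆p _ _ y∈)
  ... | inj₁ y∈p  = y∈p
  ... | inj₂ refl = ⊥-elim (x∉p-x (p ∪ ⁅ x ⁆) y∈)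

x∉p⇒∣p∣<∣p∪⁅x⁆∣ : ∀ {p : Subset n} {x} → x ∉ p → ∣ p ∣ < ∣ p ∪ ⁅ x ⁆ ∣
x∉p⇒∣p∣<∣p∪⁅x⁆∣ {p = p} {x} x∉p = p⊂q⇒∣p∣<∣q∣ (p⊆p∪q _ , x , x∈p∪⁅x⁆ p x , x∉p)

p-x∪⁅x⁆≡p : ∀ {p : Subset n} {x} → x ∈ p → (p - x) ∪ ⁅ x ⁆ ≡ p
p-x∪⁅x⁆≡p {p = p} {x} x∈p = ⊆-antisym ⊆p p⊆
  where
  ⊆p : (p - x) ∪ ⁅ x ⁆ ⊆ p
  ⊆p y∈ with x∈p∪⁅y⁆⁻ (p - x) y∈
  ... | inj₁ y∈p-x = p─q⊆p _ _ y∈p-x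
  ... | inj₂ refl  = x∈p
  p⊆ : p ⊆ (p - x) ∪ ⁅ x ⁆
  p⊆ {y} y∈p with y ≟ x
  ... | yes refl = x∈p∪⁅x⁆ _ x
  ... | no  y≢x  = x∈p∪q⁺ (inj₁ (x∈p∧x≢y⇒x∈p-y y∈p y≢x))

-x-mono-⊆ : ∀ {p q : Subset n} x → p ⊆ q → p - x ⊆ q - x
-x-mono-⊆ {p = p} x p⊆q y∈ = x∈p∧x≢y⇒x∈p-y (p⊆q (p─q⊆p _ _ y∈)) λ { refl → x∉p-x p y∈ }

∣p∣>0⇒Nonempty : ∀ (p : Subset n) → 0 < ∣ p ∣ → Nonempty p
∣p∣>0⇒Nonempty {n} p 0<∣p∣ with nonempty? p
... | yes ne = ne
... | no  ¬ne = ⊥-elim (<-irrefl (sym (trans (cong ∣_∣ (Empty-unique ¬ne)) (∣⊥∣≡0 n))) 0<∣p∣)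

length-⊆-subsets : ∀ {Ks} {B : Subset n} → Unique Ks → All (_⊆ B) Ks → length Ks ≤ 2 ^ ∣ B ∣
length-⊆-subsets {B = B} u ⊆B = subst (_ ≤_) (length-powerset B)
  (length-⊆ u λ K∈ → ⊆⇒∈-powerset (All.lookup ⊆B K∈))

-- A set through `v` arises from a subset of `B - v` by adding `v`.
length-star : ∀ {Ks v} {B : Subset n} → Unique Ks → All (λ K → v ∈ K × K ⊆ B) Ks →
              length Ks ≤ 2 ^ ∣ B - v ∣
length-star {Ks = Ks} {v} {B} u star = begin
  length Ks                                     ≤⟨ length-⊆ u ∈stars ⟩
  length (map (_∪ ⁅ v ⁆) (powerset (B - v)))    ≡⟨ length-map _ (powerset (B - v)) ⟩
  length (powerset (B - v))                     ≡⟨ length-powerset (B - v) ⟩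
  2 ^ ∣ B - v ∣                                 ∎
  where
  open ≤-Reasoning
  ∈stars : ∀ {K} → K ∈ₗ Ks → K ∈ₗ map (_∪ ⁅ v ⁆) (powerset (B - v))
  ∈stars K∈ with All.lookup star K∈
  ... | v∈K , K⊆B = subst (_∈ₗ _) (p-x∪⁅x⁆≡p v∈K)
                          (∈-map⁺ _ (⊆⇒∈-powerset (-x-mono-⊆ v K⊆B)))

-- The bound w on the sizes excludes one of the 2 ^ w sets, namely B itself if ∣ B ∣ ≡ 1 + w.
length-small-star : ∀ {w Ks v} {B : Subset n} → 1 ≤ w → ∣ B ∣ ≤ suc w → v ∈ B → Unique Ks →
                    All (λ K → v ∈ K × K ⊆ B × ∣ K ∣ ≤ w) Ks → suc (length Ks) ≤ 2 ^ w
length-small-star {w = suc w} {Ks} {v} {B} (s≤s _) ∣B∣≤ v∈B u star with ∣ B ∣ ℕ.≤? suc w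
... | yes ∣B∣≤w = begin
  suc (length Ks)      ≤⟨ s≤s (length-star u (All.map (λ (v∈K , K⊆B , _) → v∈K , λ {x} → K⊆B {x}) star)) ⟩
  suc (2 ^ ∣ B - v ∣)  ≤⟨ s≤s (^-monoʳ-≤ 2 (≤-pred (<-≤-trans (x∈p⇒∣p-x∣<∣p∣ v∈B) ∣B∣≤w))) ⟩
  1 + 2 ^ w            ≤⟨ +-monoˡ-≤ (2 ^ w) (m^n>0 2 w) ⟩
  2 ^ w + 2 ^ w        ≡⟨ cong (λ k → 2 ^ w + k) (+-identityʳ _) ⟨
  2 ^ suc w            ∎
  where open ≤-Reasoning
... | no  ∣B∣≰w = begin
  length (B ∷ Ks)   ≤⟨ length-star (B≢ ∷ u)
                         ((v∈B , λ {_} x∈ → x∈) ∷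
                          All.map (λ (v∈K , K⊆B , _) → v∈K , λ {x} → K⊆B {x}) star) ⟩
  2 ^ ∣ B - v ∣     ≤⟨ ^-monoʳ-≤ 2 (≤-pred (<-≤-trans (x∈p⇒∣p-x∣<∣p∣ v∈B) ∣B∣≤)) ⟩
  2 ^ suc w         ∎
  where
  open ≤-Reasoning
  B≢ : All (B ≢_) Ks
  B≢ = All.map (λ { (_ , _ , ∣K∣≤w) refl → ∣B∣≰w ∣K∣≤w }) star

-- Cliques of vertices sharing bags

module Bags {V : Set} (rooting : Rooting V) where
  open Rooting rooting
  open Subtrees rooting
  open IsSubtree

  module _ (bag : V → Subset n) where

    -- Restricted to `S`, this is adjacency in `H`, with loops at the vertices that occur in a bag.
    Meet : Fin n → Fin n → Set
    Meet u v = ∃[ t ] u ∈ bag t × v ∈ bag t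

    Pairwise-Meet : Subset n → Set
    Pairwise-Meet K = ∀ {u v} → u ∈ K → v ∈ K → Meet u v

    HasSubtree : (Fin n → V) → Fin n → Set
    HasSubtree top v = IsSubtree (top v) (λ t → v ∈ bag t)

    record SmallClique (w : ℕ) (S K : Subset n) : Set where
      field
        within : K ⊆ S
        size   : ∣ K ∣ ≤ w
        meet   : Pairwise-Meet K

    open SmallClique

    -- Each subtree of a member of `K` meets that of `v` and has a top of no larger rank, so it
    -- contains `top v`.
    ⊆-bag-top : ∀ {top K v} → (∀ {u} → u ∈ K → HasSubtree top u) → Pairwise-Meet K → v ∈ K →
                (∀ {u} → u ∈ K → rank (top u) ≤ rank (top v)) → K ⊆ bag (top v)
    ⊆-bag-top T meet v∈K max u∈K with meet u∈K v∈K
    ... | t , u∈t , v∈t = top∈-meeting (T u∈K) (T v∈K) u∈t v∈t (max u∈K)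

    helly : ∀ {top K} → Nonempty K → (∀ {u} → u ∈ K → HasSubtree top u) → Pairwise-Meet K →
            ∃[ t ] K ⊆ bag t
    helly {top} {K} ne T meet with ∃-maximum (_∈? K) (λ v → rank (top v)) ne
    ... | v , v∈K , max = top v , ⊆-bag-top T meet v∈K max

    -- Induction on the excess `d` of the size of `S` over `w`. For the vertex `v` of `S` whose top
    -- has the largest rank, all cliques through `v` lie in the bag at `top v`, so deleting `v`
    -- loses at most `2 ^ w - 1` of them. The summand `d` on the left records the one saved per
    -- deletion.
    length-cliques : ∀ {top w} → 1 ≤ w → (∀ t → ∣ bag t ∣ ≤ suc w) →
      ∀ d {S Ks} → ∣ S ∣ ≡ d + w → (∀ {v} → v ∈ S → HasSubtree top v) →
      Unique Ks → All (SmallClique w S) Ks → length Ks + d ≤ suc d * 2 ^ w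
    length-cliques _ _ zero {S} refl _ u cliques =
      +-monoˡ-≤ 0 (length-⊆-subsets u (All.map (λ c {x} → within c {x}) cliques))
    length-cliques {top} {w} 1≤w bag≤ (suc d) {S} {Ks} ∣S∣≡ T u cliques
      with ∃-maximum (_∈? S) (λ v → rank (top v)) (∣p∣>0⇒Nonempty S (subst (0 <_) (sym ∣S∣≡) (s≤s z≤n)))
    ... | v , v∈S , max = begin
      length Ks + suc d
        ≡⟨ cong (_+ suc d) (length-filter-¬ (v ∈?_) Ks) ⟩
      length without + length with-v + suc d
        ≡⟨ solve 3 (λ a b d → a :+ b :+ (con 1 :+ d) := con 1 :+ b :+ (a :+ d)) refl
             (length without) (length with-v) d ⟩
      suc (length with-v) + (length without + d)
        ≤⟨ +-mono-≤ bound-with bound-without ⟩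
      suc (suc d) * 2 ^ w ∎
      where
      open ≤-Reasoning
      open +-*-Solver

      without with-v : List (Subset n)
      without = filter (λ K → ¬? (v ∈? K)) Ks
      with-v  = filter (v ∈?_) Ks

      ∣S-v∣≡ : ∣ S - v ∣ ≡ d + w
      ∣S-v∣≡ = ≤-antisym (≤-pred (subst (∣ S - v ∣ <_) ∣S∣≡ (x∈p⇒∣p-x∣<∣p∣ v∈S)))
                         (≤-pred (subst (_≤ suc ∣ S - v ∣) ∣S∣≡ (∣p∣≤1+∣p-x∣ S v)))

      restrict : ∀ {K} → SmallClique w S K × v ∉ K → SmallClique w (S - v) K
      restrict (c , v∉K) = record
        { within = λ x∈K → x∈p∧x≢y⇒x∈p-y (within c x∈K) λ { refl → v∉K x∈K }
        ; size   = size c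
        ; meet   = meet c
        }

      bound-without : length without + d ≤ suc d * 2 ^ w
      bound-without = length-cliques 1≤w bag≤ d ∣S-v∣≡ (λ x∈ → T (p─q⊆p _ _ x∈))
        (Unique.filter⁺ _ u)
        (All.map restrict (All.zip (All.filter⁺ _ cliques , all-filter _ Ks)))

      star : ∀ {K} → SmallClique w S K × v ∈ K → v ∈ K × K ⊆ S ∩ bag (top v) × ∣ K ∣ ≤ w
      star (c , v∈K) = v∈K ,
        (λ x∈K → x∈p∩q⁺ (within c x∈K ,
          ⊆-bag-top (λ y∈K → T (within c y∈K)) (meet c) v∈K (λ y∈K → max (within c y∈K)) x∈K)) ,
        size c

      bound-with : suc (length with-v) ≤ 2 ^ w
      bound-with = length-small-star 1≤w (≤-trans (∣p∩q∣≤∣q∣ S (bag (top v))) (bag≤ _))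
        (x∈p∩q⁺ (v∈S , top∈ (T v∈S))) (Unique.filter⁺ _ u)
        (All.map star (All.zip (All.filter⁺ _ cliques , all-filter _ Ks)))

-- Contracting vertices outside S

_≟ₛ_ : ∀ {n} (p q : Subset n) → Dec (p ≡ q)
_≟ₛ_ = ≡-dec _≟ᵇ_

module _ {n : ℕ} (u s : Fin n) where

  contract : Subset n → Subset n
  contract B = if does (u ∈? B) then (B - u) ∪ ⁅ s ⁆ else B

  ∣contract∣≤ : ∀ B → ∣ contract B ∣ ≤ ∣ B ∣
  ∣contract∣≤ B with u ∈? B
  ... | yes u∈B = ≤-trans (∣p∪⁅x⁆∣≤1+∣p∣ (B - u) s) (x∈p⇒∣p-x∣<∣p∣ u∈B)
  ... | no  _   = ≤-refl

  ∈-contract⁺ : ∀ {v B} → v ≢ u → v ∈ B → v ∈ contract B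
  ∈-contract⁺ {B = B} v≢u v∈B with u ∈? B
  ... | yes _ = x∈p∪q⁺ (inj₁ (x∈p∧x≢y⇒x∈p-y v∈B v≢u))
  ... | no  _ = v∈B

  s∈contract⁺ : ∀ {B} → u ∈ B → s ∈ contract B
  s∈contract⁺ {B} u∈B with u ∈? B
  ... | yes _   = x∈p∪⁅x⁆ (B - u) s
  ... | no  u∉B = ⊥-elim (u∉B u∈B)

  ∈-contract⁻ : ∀ {v B} → v ∈ contract B → v ∈ B ⊎ v ≡ s × u ∈ B
  ∈-contract⁻ {B = B} v∈ with u ∈? B
  ... | no  _   = inj₁ v∈
  ... | yes u∈B with x∈p∪⁅y⁆⁻ (B - u) v∈
  ...   | inj₁ v∈B-u = inj₁ (p─q⊆p _ _ v∈B-u)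
  ...   | inj₂ v≡s   = inj₂ (v≡s , u∈B)

-- `σ u` stands for the trace of `u` on `S`; it stays fixed while contractions change the bags.
module Contraction {m n : ℕ} (rooting : Rooting (Fin m)) {w : ℕ} (2≤w : 2 ≤ w)
  (S : Subset n) (σ : Fin n → Subset n) (σ⊆S : ∀ u → σ u ⊆ S) where
  open Rooting rooting
  open Subtrees rooting
  open Bags rooting
  open IsSubtree

  -- P lists the vertices outside S not yet contracted, Q the pairs charged with past contractions.
  record Configuration (P : List (Fin n)) (Q : List (Subset n)) : Set where
    field
      bag       : Fin m → Subset n
      top       : Fin n → Fin m
      bag-size  : ∀ t → ∣ bag t ∣ ≤ suc w
      core      : ∀ {v} → v ∈ S → HasSubtree bag top v
      outer     : ∀ {u} → u ∈ₗ P → HasSubtree bag top u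
      outside-S : ∀ {u} → u ∈ₗ P → u ∉ S
      attached  : ∀ {u v} → u ∈ₗ P → v ∈ σ u → Meet bag u v
      used      : All (SmallClique bag w S) Q

  open Configuration

  pair-clique : ∀ (b : Fin m → Subset n) {x y} → x ∈ S → y ∈ S → Meet b x y →
                SmallClique b w S (⁅ x ⁆ ∪ ⁅ y ⁆)
  pair-clique b {x} {y} x∈S y∈S (t , x∈t , y∈t) = record
    { within = within
    -- The hypothesis `2 ≤ w` admits pairs among the small cliques.
    ; size   = ≤-trans (∣p∪⁅x⁆∣≤1+∣p∣ ⁅ x ⁆ y) (subst (λ k → suc k ≤ w) (sym (∣⁅x⁆∣≡1 x)) 2≤w)
    ; meet   = λ u∈ v∈ → t , ⊆t u∈ , ⊆t v∈
    }
    where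
    ∈-pair : ∀ {v} → v ∈ ⁅ x ⁆ ∪ ⁅ y ⁆ → v ≡ x ⊎ v ≡ y
    ∈-pair v∈ = Sum.map₁ (x∈⁅y⁆⇒x≡y x) (x∈p∪⁅y⁆⁻ ⁅ x ⁆ v∈)
    within : ⁅ x ⁆ ∪ ⁅ y ⁆ ⊆ S
    within v∈ with ∈-pair v∈
    ... | inj₁ refl = x∈S
    ... | inj₂ refl = y∈S
    ⊆t : ⁅ x ⁆ ∪ ⁅ y ⁆ ⊆ b t
    ⊆t v∈ with ∈-pair v∈
    ... | inj₁ refl = x∈t
    ... | inj₂ refl = y∈t

  -- The new subtree of `x` is the union of those of `x` and `u`, which meet because `x` is in the
  -- trace of `u`. Vertices other than `u` keep all their meetings, so earlier cliques survive, and
  -- `x` meets `y` wherever `u` did.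
  contract-edge : ∀ {P P′ Q u x y} → Configuration P Q → P ↭ u ∷ P′ → u ∉ₗ P′ →
                  x ∈ σ u → y ∈ σ u → Configuration P′ (⁅ x ⁆ ∪ ⁅ y ⁆ ∷ Q)
  contract-edge {P} {P′} {Q} {u} {x} {y} c P↭ u∉P′ x∈σu y∈σu = record
    { bag       = bag′
    ; top       = top′
    ; bag-size  = λ t → ≤-trans (∣contract∣≤ u x (bag c t)) (bag-size c t)
    ; core      = core′
    ; outer     = λ v∈P′ → keep (P′≢u v∈P′) (λ { refl → outside-S c (P′⊆P v∈P′) x∈S }) (outer c (P′⊆P v∈P′))
    ; outside-S = λ v∈P′ → outside-S c (P′⊆P v∈P′)
    ; attached  = λ v∈P′ z∈σv → meet′ (P′≢u v∈P′) (S≢u (σ⊆S _ z∈σv)) (attached c (P′⊆P v∈P′) z∈σv)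
    ; used      = pair-clique bag′ x∈S y∈S x-meets-y ∷
                  All.map weaken (used c)
    }
    where
    x∈S = σ⊆S u x∈σu
    y∈S = σ⊆S u y∈σu

    bag′ : Fin m → Subset n
    bag′ t = contract u x (bag c t)

    u∈P : u ∈ₗ P
    u∈P = ∈-resp-↭ (↭-sym P↭) (here refl)

    P′⊆P : ∀ {v} → v ∈ₗ P′ → v ∈ₗ P
    P′⊆P v∈P′ = ∈-resp-↭ (↭-sym P↭) (there v∈P′)

    P′≢u : ∀ {v} → v ∈ₗ P′ → v ≢ u
    P′≢u v∈P′ refl = u∉P′ v∈P′

    S≢u : ∀ {v} → v ∈ S → v ≢ u
    S≢u v∈S refl = outside-S c u∈P v∈S

    meet′ : ∀ {v z} → v ≢ u → z ≢ u → Meet (bag c) v z → Meet bag′ v z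
    meet′ v≢u z≢u (t , v∈t , z∈t) = t , ∈-contract⁺ u x v≢u v∈t , ∈-contract⁺ u x z≢u z∈t

    x-meets-y : Meet bag′ x y
    x-meets-y with attached c u∈P y∈σu
    ... | t , u∈t , y∈t = t , s∈contract⁺ u x u∈t , ∈-contract⁺ u x (S≢u y∈S) y∈t

    weaken : ∀ {K} → SmallClique (bag c) w S K → SmallClique bag′ w S K
    weaken k = record
      { within = SmallClique.within k
      ; size   = SmallClique.size k
      ; meet   = λ a∈K b∈K → meet′ (S≢u (SmallClique.within k a∈K)) (S≢u (SmallClique.within k b∈K))
                               (SmallClique.meet k a∈K b∈K)
      }

    -- The union starts at whichever of the two tops has the smaller rank.
    upper : Fin m
    upper with rank (top c x) ℕ.≤? rank (top c u)
    ... | yes _ = top c x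
    ... | no  _ = top c u

    top′ : Fin n → Fin m
    top′ v with v ≟ x
    ... | yes _ = upper
    ... | no  _ = top c v

    keep : ∀ {v} → v ≢ u → v ≢ x → HasSubtree (bag c) (top c) v → HasSubtree bag′ top′ v
    keep {v} v≢u v≢x T with v ≟ x
    ... | yes v≡x = ⊥-elim (v≢x v≡x)
    ... | no  _   = IsSubtree-resp (∈-contract⁺ u x v≢u) back T
      where
      back : ∀ {t} → v ∈ bag′ t → v ∈ bag c t
      back v∈ with ∈-contract⁻ u x v∈
      ... | inj₁ v∈t       = v∈t
      ... | inj₂ (v≡x , _) = ⊥-elim (v≢x v≡x)

    merged : IsSubtree upper (λ t → x ∈ bag′ t)
    merged with attached c u∈P x∈σu | rank (top c x) ℕ.≤? rank (top c u)
    ... | t , u∈t , x∈t | yes x≤u = IsSubtree-resp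
      Sum.[ ∈-contract⁺ u x (S≢u x∈S) , s∈contract⁺ u x ]
      (λ x∈ → Sum.map₂ proj₂ (∈-contract⁻ u x x∈))
      (union (core c x∈S) (outer c u∈P) x∈t u∈t x≤u)
    ... | t , u∈t , x∈t | no  x≰u = IsSubtree-resp
      Sum.[ s∈contract⁺ u x , ∈-contract⁺ u x (S≢u x∈S) ]
      (λ x∈ → Sum.swap (Sum.map₂ proj₂ (∈-contract⁻ u x x∈)))
      (union (outer c u∈P) (core c x∈S) u∈t x∈t (<⇒≤ (≰⇒> x≰u)))

    core-x : HasSubtree bag′ top′ x
    core-x with x ≟ x
    ... | yes _  = merged
    ... | no x≢x = ⊥-elim (x≢x refl)

    core′ : ∀ {v} → v ∈ S → HasSubtree bag′ top′ v
    core′ {v} v∈S = by-cases (v ≟ x)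
      where
      by-cases : Dec (v ≡ x) → HasSubtree bag′ top′ v
      by-cases (yes refl) = core-x
      by-cases (no  v≢x)  = keep (S≢u v∈S) v≢x (core c v∈S)

  -- A missing edge of `H` inside the trace, the obstruction to its being a clique.
  Gap : ∀ {P Q} → Configuration P Q → Fin n → Set
  Gap c u = ∃[ x ] ∃[ y ] x ∈ σ u × y ∈ σ u × ¬ Meet (bag c) x y

  meet? : ∀ {P Q} (c : Configuration P Q) x y → Dec (Meet (bag c) x y)
  meet? c x y = any? λ t → (x ∈? bag c t) ×-dec (y ∈? bag c t)

  gap? : ∀ {P Q} (c : Configuration P Q) u → Dec (Gap c u)
  gap? c u = any? λ x → any? λ y → (x ∈? σ u) ×-dec (y ∈? σ u) ×-dec ¬? (meet? c x y)

  -- Since `u` meets every member of its trace, the trace together with `u` meets pairwise, and the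
  -- Helly property puts it into one bag. There `u` takes one of the `suc w` places.
  trace-clique : ∀ {P Q u} (c : Configuration P Q) → u ∈ₗ P → ¬ Gap c u →
                 SmallClique (bag c) w S (σ u)
  trace-clique {u = u} c u∈P ¬gap = record
    { within = σ⊆S u
    ; size   = size
    ; meet   = meet
    }
    where
    meet : Pairwise-Meet (bag c) (σ u)
    meet x∈ y∈ = decidable-stable (meet? c _ _) λ ¬m → ¬gap (_ , _ , x∈ , y∈ , ¬m)

    subtree : ∀ {v} → v ∈ σ u ∪ ⁅ u ⁆ → HasSubtree (bag c) (top c) v
    subtree v∈ with x∈p∪⁅y⁆⁻ (σ u) v∈
    ... | inj₁ v∈σu = core c (σ⊆S u v∈σu)
    ... | inj₂ refl = outer c u∈P

    meet-u : Pairwise-Meet (bag c) (σ u ∪ ⁅ u ⁆)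
    meet-u v∈ z∈ with x∈p∪⁅y⁆⁻ (σ u) v∈ | x∈p∪⁅y⁆⁻ (σ u) z∈
    ... | inj₁ v∈σu | inj₁ z∈σu = meet v∈σu z∈σu
    ... | inj₂ refl | inj₁ z∈σu = attached c u∈P z∈σu
    ... | inj₁ v∈σu | inj₂ refl with attached c u∈P v∈σu
    ...   | t , u∈t , v∈t = t , v∈t , u∈t
    meet-u v∈ z∈ | inj₂ refl | inj₂ refl =
      top c u , top∈ (outer c u∈P) , top∈ (outer c u∈P)

    size : ∣ σ u ∣ ≤ w
    size with helly (bag c) (u , x∈p∪⁅x⁆ (σ u) u) subtree meet-u
    ... | t , ⊆t = ≤-pred (≤-trans (x∉p⇒∣p∣<∣p∪⁅x⁆∣ (λ u∈σu → outside-S c u∈P (σ⊆S u u∈σu)))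
                                   (≤-trans (p⊆q⇒∣p∣≤∣q∣ ⊆t) (bag-size c t)))

  -- Induction on the number of vertices left. A contraction exchanges one trace for one pair, so
  -- the list keeps its length and its members stay distinct; once no gap remains, all of them are
  -- small cliques.
  length-traces : ∀ ℓ {d P Q} → length P ≡ ℓ → Configuration P Q → Unique (map σ P ++ Q) →
                  ∣ S ∣ ≡ d + w → length (map σ P ++ Q) + d ≤ suc d * 2 ^ w
  length-traces ℓ {d} {P} {Q} ∣P∣≡ c uniq ∣S∣≡ with Any.any? (gap? c) P
  ... | no  ¬gap = length-cliques (bag c) (≤-trans (s≤s z≤n) 2≤w) (bag-size c) d ∣S∣≡ (core c) uniq
                     (All.++⁺ (All.map⁺ (All.tabulate λ u∈P → trace-clique c u∈P
                                λ gap → ¬gap (lose u∈P gap)))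
                              (used c))
  ... | yes gap with find gap
  ...   | u , u∈P , x , y , x∈σu , y∈σu , ¬meet = choose (Any.any? (λ v → pair ≟ₛ σ v) P)
    where
    pair : Subset n
    pair = ⁅ x ⁆ ∪ ⁅ y ⁆

    x∈pair : x ∈ pair
    x∈pair = x∈p∪q⁺ (inj₁ (x∈⁅x⁆ x))

    y∈pair : y ∈ pair
    y∈pair = x∈p∪⁅x⁆ ⁅ x ⁆ y

    -- The pairs charged before have become edges of `H`, while `x` and `y` do not meet yet.
    pair∉Q : pair ∉ₗ Q
    pair∉Q pair∈Q = ¬meet (SmallClique.meet (All.lookup (used c) pair∈Q) x∈pair y∈pair)

    -- One contraction of `v`, charged to the pair. The last hypothesis may use that the trace of
    -- `v` occurs only once, which settles the case where this trace is the pair itself.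
    continue : ∀ ℓ {P′ v} → length P ≡ ℓ → P ↭ v ∷ P′ → x ∈ σ v → y ∈ σ v →
               (σ v ∉ₗ map σ P′ ++ Q → pair ∉ₗ map σ P′) →
               length (map σ P ++ Q) + d ≤ suc d * 2 ^ w
    continue zero    ∣P∣≡ P↭ _ _ _ with trans (sym ∣P∣≡) (↭-length P↭)
    ... | ()
    continue (suc ℓ) {P′} {v} ∣P∣≡ P↭ x∈σv y∈σv pair∉′ =
      subst (λ k → k + d ≤ suc d * 2 ^ w) same-length
        (length-traces ℓ (suc-injective (trans (sym (↭-length P↭)) ∣P∣≡))
          (contract-edge c P↭ v∉P′ x∈σv y∈σv)
          (Unique-resp-↭ shifted (¬Any⇒All¬ _ pair∉ ∷ tail uniq′)) ∣S∣≡)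
      where
      traces↭ : map σ P ++ Q ↭ σ v ∷ map σ P′ ++ Q
      traces↭ = ↭.++⁺ʳ Q (↭.map⁺ σ P↭)

      shifted : pair ∷ map σ P′ ++ Q ↭ map σ P′ ++ pair ∷ Q
      shifted = ↭-sym (shift pair (map σ P′) Q)

      same-length : length (map σ P′ ++ pair ∷ Q) ≡ length (map σ P ++ Q)
      same-length = trans (sym (↭-length shifted)) (sym (↭-length traces↭))

      uniq′ : Unique (σ v ∷ map σ P′ ++ Q)
      uniq′ = Unique-resp-↭ traces↭ uniq

      v∉P′ : v ∉ₗ P′
      -- A second occurrence of `v` would repeat its trace.
      v∉P′ v∈P′ = Unique-head uniq′ (∈-++⁺ˡ (∈-map⁺ σ v∈P′))

      pair∉ : pair ∉ₗ map σ P′ ++ Q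
      pair∉ p∈ = Sum.[ pair∉′ (Unique-head uniq′) , pair∉Q ] (∈-++⁻ (map σ P′) p∈)

    -- A vertex whose trace is exactly {x , y} is contracted first, so that {x , y}, a clique
    -- from then on, can be charged for the contraction without being a trace itself.
    choose : Dec (Any (λ v → pair ≡ σ v) P) → length (map σ P ++ Q) + d ≤ suc d * 2 ^ w
    choose (yes p∈) with find p∈
    ... | v , v∈P , pair≡σv = continue ℓ ∣P∣≡ (proj₂ (∈⇒↭ v∈P))
          (subst (x ∈_) pair≡σv x∈pair) (subst (y ∈_) pair≡σv y∈pair)
          (λ σv∉ pair∈ → σv∉ (∈-++⁺ˡ (subst (_∈ₗ _) pair≡σv pair∈)))
    choose (no p∉) = continue ℓ ∣P∣≡ P↭ x∈σu y∈σu λ _ pair∈ →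
      let v , v∈P′ , pair≡σv = ∈-map⁻ σ pair∈ in
      p∉ (lose (∈-resp-↭ (↭-sym P↭) (there v∈P′)) pair≡σv)
      where P↭ = proj₂ (∈⇒↭ u∈P)

-- From a tree-decomposition to the bound

tree-rooting : ∀ {m} (T : Graph (Fin m)) → IsTree T →
               Σ (Rooting (Fin m)) λ rooting → ∀ {x y} → Graph._~_ T x y →
               Rooting._◁_ rooting x y ⊎ Rooting._◁_ rooting y x
tree-rooting {m} T isTree
  with Rank.absorbAll _≟_ T (IsTree.acyclic isTree)
         (λ v → IsTree.connected isTree v (IsTree.nonempty isTree)) (allFin m)
... | L , _ , all⊆L , R = rooting , orient
  where
  open Graph T using (_~_) renaming (sym to ~-sym)
  open Rank.Ranking R

  L∋ : ∀ v → v ∈ₗ L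
  L∋ v = all⊆L (∈-allFin v)

  -- The parent of a node is its neighbour of smaller rank.
  rooting : Rooting (Fin m)
  rooting = record
    { _◁_      = λ p x → p ~ x × rank p < rank x
    ; rank     = rank
    ; ◁⇒<      = proj₂
    ; ◁-unique = λ (p~x , p<x) (q~x , q<x) →
        parent-unique (L∋ _) (L∋ _) (L∋ _) p~x q~x p<x q<x
    }

  orient : ∀ {x y} → x ~ y → x ~ y × rank x < rank y ⊎ y ~ x × rank y < rank x
  orient {x} {y} x~y with <-cmp (rank x) (rank y)
  ... | tri< x<y _ _ = inj₁ (x~y , x<y)
  ... | tri≈ _ x≡y _ = ⊥-elim (rank-≢ (L∋ x) (L∋ y) x~y x≡y)
  ... | tri> _ _ y<x = inj₂ (~-sym x~y , y<x)

-- Keeping one vertex per trace provides the distinct traces from which the contractions start.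
representatives : ∀ {A : Set} {n} (f : A → Subset n) xs →
  ∃[ ys ] (∀ {y} → y ∈ₗ ys → y ∈ₗ xs) × Unique (map f ys) ×
          (∀ {x} → x ∈ₗ xs → f x ∈ₗ map f ys)
representatives f [] = [] , (λ ()) , [] , λ ()
representatives f (x ∷ xs) with representatives f xs
... | ys , ys⊆xs , uniq , covers with Any.any? (f x ≟ₛ_) (map f ys)
...   | yes fx∈ = ys , (λ y∈ → there (ys⊆xs y∈)) , uniq ,
                  λ { (here refl) → fx∈ ; (there z∈) → covers z∈ }
...   | no  fx∉ = x ∷ ys , (λ { (here refl) → here refl ; (there y∈) → there (ys⊆xs y∈) }) ,
                  ¬Any⇒All¬ _ fx∉ ∷ uniq ,
                  λ { (here refl) → here refl ; (there z∈) → there (covers z∈) }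

module _ {n : ℕ} (G : Graph (Fin n)) where
  open Graph G using (_~_; _~?_) renaming (sym to ~-sym)

  N⇒~ : ∀ {u v} → v ∈ N[_] G u → v ≢ u → u ~ v
  N⇒~ {u} {v} v∈ v≢u with v ≟ u | u ~? v | trans (sym (lookup∘tabulate _ v)) ([]=⇒lookup v∈)
  ... | yes v≡u | _       | _  = ⊥-elim (v≢u v≡u)
  ... | no  _   | yes u~v | _  = u~v
  ... | no  _   | no  _   | ()

  bag-size≤ : ∀ {w} (D : TreeDecomposition G) → TreeDecomposition.width D ≡ + w →
              ∀ t → ∣ TreeDecomposition.bag D t ∣ ≤ suc w
  bag-size≤ {w} D width≡w t =
    ≤-trans (All.lookup (xs≤max 0 sizes) (∈-map⁺ _ (∈-allFin t))) (bound _ width≡w)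
    where
    sizes : List ℕ
    sizes = map (λ t → ∣ TreeDecomposition.bag D t ∣) (allFin _)

    bound : ∀ k → k ⊖ 1 ≡ + w → k ≤ suc w
    bound zero    _  = z≤n
    bound (suc k) eq = s≤s (≤-reflexive (ℤ.+-injective eq))

  nc-bound : ∀ {w d} (D : TreeDecomposition G) → TreeDecomposition.width D ≡ + w → 2 ≤ w →
             ∀ {S} → ∣ S ∣ ≡ d + w → nc G S ≤ suc d * 2 ^ w + w
  nc-bound {w} {d} D width≡w 2≤w {S} ∣S∣≡
    with tree-rooting (TreeDecomposition.tree D) (TreeDecomposition.isTree D)
       | representatives (λ u → N[_] G u ∩ S) (filter (λ u → ¬? (u ∈? S)) (allFin n))
  ... | rooting , orient | P , P⊆ , uniq , covers = begin
    nc G S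
      ≤⟨ length-⊆ (UniqueDec.deduplicate-! _≟ₛ_ _) traces⊆ ⟩
    length (map σ (elements S) ++ map σ P)
      ≡⟨ length-++ (map σ (elements S)) ⟩
    length (map σ (elements S)) + length (map σ P)
      ≡⟨ cong₂ _+_ (trans (length-map σ (elements S)) (trans (length-elements S) ∣S∣≡))
                   (cong length (sym (++-identityʳ (map σ P)))) ⟩
    -- Of the `d + w` traces from `S`, the part `d` is absorbed by the saving in `length-traces`;
    -- only `w` remains as an extra term.
    d + w + length (map σ P ++ [])
      ≡⟨ solve 3 (λ d w l → d :+ w :+ l := l :+ d :+ w) refl d w (length (map σ P ++ [])) ⟩
    length (map σ P ++ []) + d + w
      ≤⟨ +-monoˡ-≤ w (length-traces (length P) refl initial
           (subst Unique (sym (++-identityʳ (map σ P))) uniq) ∣S∣≡) ⟩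
    suc d * 2 ^ w + w ∎
    where
    open ≤-Reasoning
    open +-*-Solver
    open TreeDecomposition D
    open Rooting rooting
    open Subtrees rooting
    open Bags rooting

    σ : Fin n → Subset n
    σ u = N[_] G u ∩ S

    open Contraction rooting 2≤w S σ (λ u → p∩q⊆q (N[_] G u) S)

    traces⊆ : ∀ {K} → K ∈ₗ deduplicate _≟ₛ_ (map σ (allFin n)) →
              K ∈ₗ map σ (elements S) ++ map σ P
    traces⊆ K∈ with ∈-map⁻ σ (∈-deduplicate⁻ _≟ₛ_ (map σ (allFin n)) K∈)
    ... | u , u∈ , refl with u ∈? S
    ...   | yes u∈S = ∈-++⁺ˡ (∈-map⁺ σ (∈-elements u∈S))
    ...   | no  u∉S = ∈-++⁺ʳ _ (covers (∈-filter⁺ _ u∈ u∉S))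

    outside-S′ : ∀ {u} → u ∈ₗ P → u ∉ S
    outside-S′ u∈P = proj₂ (∈-filter⁻ (λ u → ¬? (u ∈? S)) {xs = allFin n} (P⊆ u∈P))

    highest : ∀ v → ∃[ t ] v ∈ bag t × ∀ {s} → v ∈ bag s → rank t ≤ rank s
    highest v = ∃-minimum (λ t → v ∈? bag t) rank (IsTree.nonempty (subtree v))

    subtrees : ∀ v → HasSubtree bag (λ v → proj₁ (highest v)) v
    subtrees v with (v∈t , min) ← proj₂ (highest v) =
      connected⇒isSubtree tree orient (IsTree.connected (subtree v)) v∈t min

    initial : Configuration P []
    initial = record
      { bag       = bag
      ; top       = λ v → proj₁ (highest v)
      ; bag-size  = bag-size≤ D width≡w
      ; core      = λ {v} _ → subtrees v
      ; outer     = λ {v} _ → subtrees v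
      ; outside-S = outside-S′
      ; attached  = λ {u} u∈P v∈σu → let v∈N , v∈S = x∈p∩q⁻ (N[_] G u) S v∈σu in
          edge-covered _ _ (N⇒~ v∈N λ { refl → outside-S′ u∈P v∈S })
      ; used      = []
      }

theorem3 : ∀ {n : ℕ} (G : Graph (Fin n)) (w k : ℕ) →
    IsTreewidth G (+ w) → 2 ≤ w → w + 1 ≤ k → k ≤ n →
    ncₖ G k ≤ (k ∸ w + 1) * 2 ^ w + w
theorem3 {n} G w k ((D , width≡w) , _) 2≤w w+1≤k _ =
  max≤v⁺ z≤n (All.map⁺ (All.map bound (all-filter (λ S → ∣ S ∣ ℕ.≟ k) (allSubsets n))))
  where
  bound : ∀ {S} → ∣ S ∣ ≡ k → nc G S ≤ (k ∸ w + 1) * 2 ^ w + w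
  bound {S} ∣S∣≡k = subst (λ j → nc G S ≤ j * 2 ^ w + w) (+-comm 1 (k ∸ w))
    (nc-bound G D width≡w 2≤w
      -- Here `d` is `k ∸ w`, a true difference because `w ≤ k`.
      (trans ∣S∣≡k (sym (m∸n+n≡m (≤-trans (m≤m+n w 1) w+1≤k)))))
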